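{- Let $P$ be a poset and let $f\colon P\to P$ be an order-preserving map. If $X\subseteq P$ is downward directed and closed under $f$ (i.e. $f(x)\in X$ for all $x\in X$), and $f$ is decreasing on $X$ (i.e. $f(x)\le x$ for all $x\in X$), then $f^\sigma(\bigwedge X)=\bigwedge X$ in the canonical extension $P^\sigma$ of $P$ (where $\bigwedge X$ is the meet taken in $P^\sigma$).
   Context: A completion of a poset $P$ is a pair $\langle e,C\rangle$ where $C$ is a complete lattice and $e$ is an order embedding of $P$ into $C$ preserving all existing finite meets and joins of $P$. An element of $C$ is open (resp. closed) if it equals $\bigvee e(X)$ (resp. $\bigwedge e(X)$), taken in $C$, for some subset $X$ of $P$; $O$ and $K$ denote the sets of open and closed elements. The completion is dense if every element of $C$ is both a join of closed elements and a meet of open elements; it is compact if for any $A\subseteq K$ and $B\subseteq O$, $\bigwedge A\le\bigvee B$ if and only if there are finite subsets $A_0$ of $A$ and $B_0$ of $B$ with $\bigwedge A_0\le\bigvee B_0$. A dense and compact completion is called a canonical extension; every poset $P$ has one, unique up to a lattice isomorphism commuting with the embeddings, and it is denoted $P^\sigma$, with $P$ identified with its image. For $f\colon P\to P$, the map $f^\sigma\colon P^\sigma\to P^\sigma$ is $$f^\sigma(x)=\bigvee\bigl\{\bigwedge\{f(a)\mid a\in P,\ p\le a\le q\}\mid p\in K,\ q\in O,\ p\le x\le q\bigr\}.$$ As usual, a set is downward directed if it is nonempty and any two of its elements have a common lower bound in it. -}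

module Defs where

open import Data.Fin.Base using (Fin)
open import Data.Nat.Base using (ℕ)
open import Data.Product.Base using (Σ; Σ-syntax; ∃; ∃-syntax; _×_; _,_; proj₁)
open import Function.Base using (_∘_)
open import Function.Bundles using (_⇔_)
open import Level using (Level; _⊔_; suc; Lift; lower)
open import Relation.Binary.Bundles using (Poset)
open import Relation.Binary.Morphism.Structures using (IsOrderMonomorphism)
open import Relation.Unary using (Pred; _∈_; Satisfiable)

module _ {a ℓ₁ ℓ₂} (P : Poset a ℓ₁ ℓ₂) where

  open Poset P

  IsSup : ∀ {i} {I : Set i} → (I → Carrier) → Carrier → Set (a ⊔ ℓ₂ ⊔ i)
  IsSup g x = (∀ i → g i ≤ x) × (∀ y → (∀ i → g i ≤ y) → x ≤ y)

  IsInf : ∀ {i} {I : Set i} → (I → Carrier) → Carrier → Set (a ⊔ ℓ₂ ⊔ i)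
  IsInf g x = (∀ i → x ≤ g i) × (∀ y → (∀ i → y ≤ g i) → y ≤ x)

  record IsDownDirected {s} (X : Pred Carrier s) : Set (a ⊔ ℓ₂ ⊔ s) where
    field
      nonempty   : Satisfiable X
      lowerBound : ∀ {x y} → x ∈ X → y ∈ X → ∃[ z ] (z ∈ X × z ≤ x × z ≤ y)

-- Subsets of a complete lattice are given as families indexed by types in
-- Set ι. Using predicates on the carrier instead would force ι to be at least
-- the level of the carrier, and such lattices cannot be built predicatively
-- except in trivial cases.
record CompleteLattice (c ℓ₁ ℓ₂ ι : Level) : Set (suc (c ⊔ ℓ₁ ⊔ ℓ₂ ⊔ ι)) where
  field
    poset : Poset c ℓ₁ ℓ₂

  open Poset poset public

  field
    ⋁ ⋀     : {I : Set ι} → (I → Carrier) → Carrier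
    ⋁-isSup : {I : Set ι} (g : I → Carrier) → IsSup poset g (⋁ g)
    ⋀-isInf : {I : Set ι} (g : I → Carrier) → IsInf poset g (⋀ g)

  ⋁ᶠ ⋀ᶠ : {n : ℕ} → (Fin n → Carrier) → Carrier
  ⋁ᶠ g = ⋁ (g ∘ lower {ℓ = ι})
  ⋀ᶠ g = ⋀ (g ∘ lower {ℓ = ι})

module _ {a ℓ₁ ℓ₂} (P : Poset a ℓ₁ ℓ₂) where

  private
    module P = Poset P

    -- Large enough for singletons and principal up- and down-sets of P.
    s : Level
    s = a ⊔ ℓ₁ ⊔ ℓ₂

  -- Lattice joins and meets range over families in Set ι with
  -- ι = suc (a ⊔ ℓ₁ ⊔ ℓ₂) ⊔ r, so that families indexed by the subsets of P
  -- are included.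
  record Completion (c e r : Level) : Set (suc (suc s ⊔ c ⊔ e ⊔ r)) where
    field
      lattice : CompleteLattice c e r (suc s ⊔ r)

    open CompleteLattice lattice public

    field
      embed       : P.Carrier → Carrier
      isEmbedding : IsOrderMonomorphism P._≈_ _≈_ P._≤_ _≤_ embed
      -- n = 0 is included: a least or greatest element of P is preserved.
      preserves-⋁ : ∀ {n} (g : Fin n → P.Carrier) {x} →
                    IsSup P g x → IsSup poset (embed ∘ g) (embed x)
      preserves-⋀ : ∀ {n} (g : Fin n → P.Carrier) {x} →
                    IsInf P g x → IsInf poset (embed ∘ g) (embed x)

    ⋁ᴾ ⋀ᴾ : Pred P.Carrier s → Carrier
    ⋁ᴾ X = ⋁ {I = Lift (suc s ⊔ r) (∃ X)} (embed ∘ proj₁ ∘ lower)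
    ⋀ᴾ X = ⋀ {I = Lift (suc s ⊔ r) (∃ X)} (embed ∘ proj₁ ∘ lower)

    IsOpen IsClosed : Pred Carrier (suc s ⊔ e)
    IsOpen   x = ∃[ X ] (x ≈ ⋁ᴾ X)
    IsClosed x = ∃[ X ] (x ≈ ⋀ᴾ X)

    IsDense : Set (suc (suc s ⊔ r) ⊔ c ⊔ e)
    IsDense = ∀ x →
      (Σ[ I ∈ Set (suc s ⊔ r) ] Σ[ g ∈ (I → Carrier) ]
        ((∀ i → IsClosed (g i)) × x ≈ ⋁ g))
      ×
      (Σ[ I ∈ Set (suc s ⊔ r) ] Σ[ g ∈ (I → Carrier) ]
        ((∀ i → IsOpen (g i)) × x ≈ ⋀ g))

    -- A finite subset of the family A : I → Carrier is A ∘ i with i : Fin m → I.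
    IsCompact : Set (suc (suc s ⊔ r) ⊔ c ⊔ e)
    IsCompact = {I J : Set (suc s ⊔ r)} (A : I → Carrier) (B : J → Carrier) →
      (∀ i → IsClosed (A i)) → (∀ j → IsOpen (B j)) →
      (⋀ A ≤ ⋁ B) ⇔
      (∃[ m ] ∃[ n ] Σ[ i ∈ (Fin m → I) ] Σ[ j ∈ (Fin n → J) ]
        (⋀ᶠ (A ∘ i) ≤ ⋁ᶠ (B ∘ j)))

    -- The closed elements p ≤ x and open elements q ≥ x are enumerated as
    -- p = ⋀ᴾ X and q = ⋁ᴾ Y, which keeps the index type of the join in Set ι.
    _^σ : (P.Carrier → P.Carrier) → Carrier → Carrier
    (f ^σ) x = ⋁ {I = Interval} λ ((X , Y) , _) →
               ⋀ {I = Lift (suc s) (Between X Y)} λ a →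
               embed (f (proj₁ (lower a)))
      where
      Interval : Set (suc s ⊔ r)
      Interval = Σ[ (X , Y) ∈ Pred P.Carrier s × Pred P.Carrier s ]
                   (⋀ᴾ X ≤ x × x ≤ ⋁ᴾ Y)

      Between : Pred P.Carrier s → Pred P.Carrier s → Set (a ⊔ r)
      Between X Y = ∃[ a ] (⋀ᴾ X ≤ embed a × embed a ≤ ⋁ᴾ Y)

  record CanonicalExtension (c e r : Level) : Set (suc (suc s ⊔ c ⊔ e ⊔ r)) where
    field
      completion : Completion c e r

    open Completion completion public

    field
      dense   : IsDense
      compact : IsCompact

{-# OPTIONS --safe #-}

-- For a downward directed X, compactness turns ⋀X ≤ ⋁Y into x ≤ ⋁Y for a
-- single x ∈ X. Hence, for closed p and open q with p ≤ ⋀X ≤ q, the elements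
-- of X lying in [p , q] are coinitial in X, and f a ≤ a there bounds the meet
-- of f over [p , q] by ⋀X. Conversely, for any x₀ ∈ X, each a in [⋀X , x₀]
-- lies above some x ∈ X, so f a ≥ f x ≥ ⋀X because f x ∈ X.
module Submission where

open import Data.Fin.Base using (Fin; zero; suc)
open import Data.Nat.Base using (zero; suc)
open import Data.Product.Base using (∃; ∃-syntax; _×_; _,_; proj₁; proj₂)
open import Defs
open import Function.Base using (_∘_)
open import Function.Bundles using (Equivalence)
open import Level using (Level; _⊔_; Lift; lift; lower)
open import Relation.Binary.Bundles using (Poset)
open import Relation.Binary.Core using (_Preserves_⟶_)
open import Relation.Binary.Morphism.Structures using (IsOrderMonomorphism)
open import Relation.Unary using (Pred; _∈_)

module _ {a ℓ₁ ℓ₂} {P : Poset a ℓ₁ ℓ₂} where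

  open Poset P

  -- Induction on `n`. The empty family, which compactness may return, is settled by nonemptiness of
  -- `X`.
  finiteLowerBound : ∀ {s} {X : Pred Carrier s} → IsDownDirected P X →
    ∀ {n} (g : Fin n → ∃ X) → ∃[ z ] (z ∈ X × (∀ i → z ≤ proj₁ (g i)))
  finiteLowerBound D {zero} g =
    let z , z∈X = IsDownDirected.nonempty D in z , z∈X , λ ()
  finiteLowerBound D {suc n} g =
    let y , y∈X , y≤g = finiteLowerBound D (g ∘ suc)
        z , z∈X , z≤g₀ , z≤y = IsDownDirected.lowerBound D (proj₂ (g zero)) y∈X
    in z , z∈X , λ { zero → z≤g₀ ; (suc i) → trans z≤y (y≤g i) }

module _ {a ℓ₁ ℓ₂ c e r} {P : Poset a ℓ₁ ℓ₂} (C : Completion P c e r) where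

  private
    module P = Poset P
    s : Level
    s = a ⊔ ℓ₁ ⊔ ℓ₂

  open Completion C
  open IsOrderMonomorphism isEmbedding using (mono)

  -- `Lift` raises the order to level `s`, where `⋁ᴾ` and `⋀ᴾ` take their subsets.
  ↓ ↑ : P.Carrier → Pred P.Carrier s
  ↓ x y = Lift s (y P.≤ x)
  ↑ x y = Lift s (x P.≤ y)

  ⋁ᴾ-upper : ∀ {X x} → x ∈ X → embed x ≤ ⋁ᴾ X
  ⋁ᴾ-upper x∈X = proj₁ (⋁-isSup _) (lift (_ , x∈X))

  ⋁ᴾ-least : ∀ {X y} → (∀ {x} → x ∈ X → embed x ≤ y) → ⋁ᴾ X ≤ y
  ⋁ᴾ-least h = proj₂ (⋁-isSup _) _ λ x → h (proj₂ (lower x))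

  ⋀ᴾ-lower : ∀ {X x} → x ∈ X → ⋀ᴾ X ≤ embed x
  ⋀ᴾ-lower x∈X = proj₁ (⋀-isInf _) (lift (_ , x∈X))

  ⋀ᴾ-greatest : ∀ {X y} → (∀ {x} → x ∈ X → y ≤ embed x) → y ≤ ⋀ᴾ X
  ⋀ᴾ-greatest h = proj₂ (⋀-isInf _) _ λ x → h (proj₂ (lower x))

  -- With its dual below, makes each element of `P` both open and closed, so that compactness
  -- applies to families drawn from `P`.
  embed≈⋁ᴾ↓ : ∀ x → embed x ≈ ⋁ᴾ (↓ x)
  embed≈⋁ᴾ↓ x = antisym (⋁ᴾ-upper (lift P.refl)) (⋁ᴾ-least (mono ∘ lower))

  embed≈⋀ᴾ↑ : ∀ x → embed x ≈ ⋀ᴾ (↑ x)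
  embed≈⋀ᴾ↑ x = antisym (⋀ᴾ-greatest (mono ∘ lower)) (⋀ᴾ-lower (lift P.refl))

  -- Compactness yields finite subfamilies of `X` and `Y`. By directedness some element of `X` lies
  -- below the meet of the first, while the join of the second lies below `⋁ᴾ Y`.
  directed-compact : IsCompact → ∀ {X Y} → IsDownDirected P X →
    ⋀ᴾ X ≤ ⋁ᴾ Y → ∃[ x ] (x ∈ X × embed x ≤ ⋁ᴾ Y)
  directed-compact compact D ⋀X≤⋁Y =
    let _ , _ , i , j , ⋀ᶠ≤⋁ᶠ = Equivalence.to
          (compact _ _ (λ x → _ , embed≈⋀ᴾ↑ (proj₁ (lower x)))
                       (λ y → _ , embed≈⋁ᴾ↓ (proj₁ (lower y)))) ⋀X≤⋁Y
        x , x∈X , x≤ = finiteLowerBound D (lower ∘ i)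
    in x , x∈X ,
       trans (proj₂ (⋀-isInf _) _ λ k → mono (x≤ (lower k)))
      (trans ⋀ᶠ≤⋁ᶠ
             (proj₂ (⋁-isSup _) _ λ k → proj₁ (⋁-isSup _) (j (lower k))))

lemma4p9 : ∀ {a ℓ₁ ℓ₂ c e r : Level}
    (P : Poset a ℓ₁ ℓ₂) (Pσ : CanonicalExtension P c e r) →
    let module P = Poset P
        open CanonicalExtension Pσ in
    (f : P.Carrier → P.Carrier) → f Preserves P._≤_ ⟶ P._≤_ →
    (X : Pred P.Carrier (a ⊔ ℓ₁ ⊔ ℓ₂)) → IsDownDirected P X →
    (∀ {x} → x ∈ X → f x ∈ X) →
    (∀ {x} → x ∈ X → f x P.≤ x) →
    (f ^σ) (⋀ᴾ X) ≈ ⋀ᴾ X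
lemma4p9 P Pσ f f-mono X D f-closed f-decreasing = antisym
  (proj₂ (⋁-isSup _) _ λ { (_ , ⋀Z≤⋀X , ⋀X≤⋁Y) → ⋀ᴾ-greatest completion λ x∈X →
    -- A lower bound `z` in `X` of `x` and `x₀` stays in the interval, so the inner meet is at most
    -- `f z`, hence at most `z` and `x`.
    let x₀ , x₀∈X , x₀≤⋁Y = directed-compact completion compact D ⋀X≤⋁Y
        z , z∈X , z≤x , z≤x₀ = lowerBound x∈X x₀∈X
    in trans
      (proj₁ (⋀-isInf _)
        (lift (z , trans ⋀Z≤⋀X (⋀ᴾ-lower completion z∈X)
                 , trans (mono z≤x₀) x₀≤⋁Y)))
      (mono (P.trans (f-decreasing z∈X) z≤x)) })
  (let x₀ , x₀∈X = nonempty
   in trans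
    (proj₂ (⋀-isInf _) _ λ { (lift (b , ⋀X≤b , _)) →
      -- Viewing `b` as the open element `⋁ᴾ (↓ b)` lets compactness find an element of `X` below
      -- it.
      let x , x∈X , x≤⋁↓b = directed-compact completion compact D
            (trans ⋀X≤b (reflexive (embed≈⋁ᴾ↓ completion b)))
          x≤b = cancel (trans x≤⋁↓b
            (reflexive (Eq.sym (embed≈⋁ᴾ↓ completion b))))
      in trans (⋀ᴾ-lower completion (f-closed x∈X)) (mono (f-mono x≤b)) })
    (proj₁ (⋁-isSup _)
      -- The interval runs from `⋀ᴾ X` itself up to `x₀`, an open element above it provided by
      -- nonemptiness.
      ((X , ↓ completion x₀) , refl
        , trans (⋀ᴾ-lower completion x₀∈X)
                (reflexive (embed≈⋁ᴾ↓ completion x₀)))))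
  where
  module P = Poset P
  open CanonicalExtension Pσ
  open IsOrderMonomorphism isEmbedding using (mono; cancel)
  open IsDownDirected D
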